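{- The logic $\mathrm{RmbC}$ is decidable, i.e. the set of theorems of $\mathrm{RmbC}$ is recursive.
   Context: Formulas are built from a countably infinite set of propositional variables $\{p_n:n\in\mathbb{N}\}$ using binary $\wedge,\vee,\to$ and unary $\neg,\circ$; $\alpha\leftrightarrow\beta$ abbreviates $(\alpha\to\beta)\wedge(\beta\to\alpha)$. The logic $\mathrm{RmbC}$ is given by the Hilbert calculus with axiom schemas $\alpha\to(\beta\to\alpha)$; $(\alpha\to(\beta\to\gamma))\to((\alpha\to\beta)\to(\alpha\to\gamma))$; $\alpha\to(\beta\to(\alpha\wedge\beta))$; $(\alpha\wedge\beta)\to\alpha$; $(\alpha\wedge\beta)\to\beta$; $\alpha\to(\alpha\vee\beta)$; $\beta\to(\alpha\vee\beta)$; $(\alpha\to\gamma)\to((\beta\to\gamma)\to((\alpha\vee\beta)\to\gamma))$; $(\alpha\to\beta)\vee\alpha$; $\alpha\vee\neg\alpha$; $\circ\alpha\to(\alpha\to(\neg\alpha\to\beta))$; and inference rules: modus ponens (from $\alpha$ and $\alpha\to\beta$ infer $\beta$); $(R_\neg)$: from $\alpha\leftrightarrow\psi$ infer $\neg\alpha\leftrightarrow\neg\psi$; $(R_\circ)$: from $\alpha\leftrightarrow\psi$ infer $\circ\alpha\leftrightarrow\circ\psi$. The theorems of $\mathrm{RmbC}$ are the formulas derivable in this calculus (without premises). -}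

module Defs where

open import Data.Nat using (ℕ)

infix  35 ¬̇_ ∘̇_
infixr 30 _∧̇_
infixr 29 _∨̇_
infixr 28 _⇒_
infix  27 _⇔̇_
infix  10 ⊢_

data Formula : Set where
  var  : ℕ → Formula
  _∧̇_  : Formula → Formula → Formula
  _∨̇_  : Formula → Formula → Formula
  _⇒_  : Formula → Formula → Formula
  ¬̇_   : Formula → Formula
  ∘̇_   : Formula → Formula

_⇔̇_ : Formula → Formula → Formula
α ⇔̇ β = (α ⇒ β) ∧̇ (β ⇒ α)

-- Derivability in RmbC from no premises. There is no context, so the
-- global rules R¬ and R∘ apply to theorems only.
data ⊢_ : Formula → Set where
  ax-K   : ∀ α β   → ⊢ α ⇒ (β ⇒ α)
  ax-S   : ∀ α β γ → ⊢ (α ⇒ (β ⇒ γ)) ⇒ ((α ⇒ β) ⇒ (α ⇒ γ))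
  ax-∧I  : ∀ α β   → ⊢ α ⇒ (β ⇒ (α ∧̇ β))
  ax-∧E₁ : ∀ α β   → ⊢ (α ∧̇ β) ⇒ α
  ax-∧E₂ : ∀ α β   → ⊢ (α ∧̇ β) ⇒ β
  ax-∨I₁ : ∀ α β   → ⊢ α ⇒ (α ∨̇ β)
  ax-∨I₂ : ∀ α β   → ⊢ β ⇒ (α ∨̇ β)
  ax-∨E  : ∀ α β γ → ⊢ (α ⇒ γ) ⇒ ((β ⇒ γ) ⇒ ((α ∨̇ β) ⇒ γ))
  ax-⇒∨  : ∀ α β   → ⊢ (α ⇒ β) ∨̇ α
  ax-EM  : ∀ α     → ⊢ α ∨̇ (¬̇ α)
  ax-bc  : ∀ α β   → ⊢ (∘̇ α) ⇒ (α ⇒ ((¬̇ α) ⇒ β))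
  MP     : ∀ {α β} → ⊢ α → ⊢ α ⇒ β → ⊢ β
  R¬     : ∀ {α ψ} → ⊢ α ⇔̇ ψ → ⊢ (¬̇ α) ⇔̇ (¬̇ ψ)
  R∘     : ∀ {α ψ} → ⊢ α ⇔̇ ψ → ⊢ (∘̇ α) ⇔̇ (∘̇ ψ)

{-# OPTIONS --safe #-}

-- Type elimination over the subformulas S of φ. A world is a truth assignment
-- to S. Any finite list W of worlds yields a Boolean algebra of subsets of W
-- with operations ¬ and ∘ satisfying all axioms and respecting equality on W,
-- hence a model of RmbC. Starting from all worlds, repeatedly delete those that
-- disagree with this model about some ¬β or ∘β in S. Each deleted world is
-- refutable, because a formula of S true throughout W is a theorem, so that R¬
-- and R∘ apply to formulas of S that agree on W. When nothing more is deleted,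
-- a formula of S is a theorem iff it holds at every remaining world.
module Submission where

open import Data.Bool using (Bool; true; false; _∧_; _∨_; not)
import Data.Bool.Properties as Bool
open import Data.List using (List; []; _∷_; _++_; map; filter; length)
open import Data.List.Properties using (filter-notAll)
open import Data.List.Membership.Propositional using (_∈_; find; lose)
open import Data.List.Membership.Propositional.Properties
  using (∈-++⁺ˡ; ∈-++⁺ʳ; ∈-++⁻; ∈-map⁺; ∈-filter⁺)
open import Data.List.Relation.Binary.Subset.Propositional using (_⊆_)
open import Data.List.Relation.Unary.All as All using (All; []; _∷_; all?)
open import Data.List.Relation.Unary.All.Properties using (¬All⇒Any¬)
open import Data.List.Relation.Unary.Any as Any using (Any; here; there; any?)
import Data.Nat as ℕ
open import Data.Nat.Induction using (<-wellFounded)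
open import Data.Product using (∃; _×_; _,_; uncurry)
open import Data.Sum using (inj₁; inj₂)
open import Data.Unit using (⊤; tt)
open import Function using (_∘_; id; mk⇔)
open import Induction.WellFounded using (Acc; acc)
open import Relation.Binary.Definitions using (DecidableEquality)
open import Relation.Binary.PropositionalEquality
  using (_≡_; refl; sym; trans; cong; cong₂; subst)
open import Relation.Nullary using (¬_; Dec; yes; no; does; contradiction)
open import Relation.Nullary.Decidable using (map′; _×-dec_; does-⇔)
open import Relation.Unary using (Decidable)
open import Defs

-- Decidable equality of formulas.

infix 4 _≟_
_≟_ : DecidableEquality Formula
var m ≟ var n = map′ (cong var) (λ { refl → refl }) (m ℕ.≟ n)
var _ ≟ (_ ∧̇ _) = no λ ()
var _ ≟ (_ ∨̇ _) = no λ ()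
var _ ≟ (_ ⇒ _) = no λ ()
var _ ≟ (¬̇ _) = no λ ()
var _ ≟ (∘̇ _) = no λ ()
(_ ∧̇ _) ≟ var _ = no λ ()
(α ∧̇ β) ≟ (α′ ∧̇ β′) =
  map′ (uncurry (cong₂ _∧̇_)) (λ { refl → refl , refl }) (α ≟ α′ ×-dec β ≟ β′)
(_ ∧̇ _) ≟ (_ ∨̇ _) = no λ ()
(_ ∧̇ _) ≟ (_ ⇒ _) = no λ ()
(_ ∧̇ _) ≟ (¬̇ _) = no λ ()
(_ ∧̇ _) ≟ (∘̇ _) = no λ ()
(_ ∨̇ _) ≟ var _ = no λ ()
(_ ∨̇ _) ≟ (_ ∧̇ _) = no λ ()
(α ∨̇ β) ≟ (α′ ∨̇ β′) =
  map′ (uncurry (cong₂ _∨̇_)) (λ { refl → refl , refl }) (α ≟ α′ ×-dec β ≟ β′)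
(_ ∨̇ _) ≟ (_ ⇒ _) = no λ ()
(_ ∨̇ _) ≟ (¬̇ _) = no λ ()
(_ ∨̇ _) ≟ (∘̇ _) = no λ ()
(_ ⇒ _) ≟ var _ = no λ ()
(_ ⇒ _) ≟ (_ ∧̇ _) = no λ ()
(_ ⇒ _) ≟ (_ ∨̇ _) = no λ ()
(α ⇒ β) ≟ (α′ ⇒ β′) =
  map′ (uncurry (cong₂ _⇒_)) (λ { refl → refl , refl }) (α ≟ α′ ×-dec β ≟ β′)
(_ ⇒ _) ≟ (¬̇ _) = no λ ()
(_ ⇒ _) ≟ (∘̇ _) = no λ ()
(¬̇ _) ≟ var _ = no λ ()
(¬̇ _) ≟ (_ ∧̇ _) = no λ ()
(¬̇ _) ≟ (_ ∨̇ _) = no λ ()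
(¬̇ _) ≟ (_ ⇒ _) = no λ ()
(¬̇ α) ≟ (¬̇ α′) = map′ (cong ¬̇_) (λ { refl → refl }) (α ≟ α′)
(¬̇ _) ≟ (∘̇ _) = no λ ()
(∘̇ _) ≟ var _ = no λ ()
(∘̇ _) ≟ (_ ∧̇ _) = no λ ()
(∘̇ _) ≟ (_ ∨̇ _) = no λ ()
(∘̇ _) ≟ (_ ⇒ _) = no λ ()
(∘̇ _) ≟ (¬̇ _) = no λ ()
(∘̇ α) ≟ (∘̇ α′) = map′ (cong ∘̇_) (λ { refl → refl }) (α ≟ α′)

-- Derivation from hypotheses.

infix 4 _⊩_
-- R¬ and R∘ enter only through `thm`, so modus ponens is the sole rule acting on hypotheses and the
-- deduction theorem `ded` holds.
data _⊩_ (Γ : List Formula) : Formula → Set where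
  thm : ∀ {α} → ⊢ α → Γ ⊩ α
  hyp : ∀ {α} → α ∈ Γ → Γ ⊩ α
  mp  : ∀ {α β} → Γ ⊩ α → Γ ⊩ α ⇒ β → Γ ⊩ β

weaken : ∀ {Γ Δ α} → Γ ⊆ Δ → Γ ⊩ α → Δ ⊩ α
weaken Γ⊆Δ (thm d)  = thm d
weaken Γ⊆Δ (hyp i)  = hyp (Γ⊆Δ i)
weaken Γ⊆Δ (mp d e) = mp (weaken Γ⊆Δ d) (weaken Γ⊆Δ e)

close : ∀ {α} → [] ⊩ α → ⊢ α
close (thm d)  = d
close (mp d e) = MP (close d) (close e)

⇒-refl : ∀ α → ⊢ α ⇒ α
⇒-refl α = MP (ax-K α α) (MP (ax-K α (α ⇒ α)) (ax-S α (α ⇒ α) α))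

ded : ∀ {Γ α β} → α ∷ Γ ⊩ β → Γ ⊩ α ⇒ β
ded (thm d)           = mp (thm d) (thm (ax-K _ _))
ded (hyp (here refl)) = thm (⇒-refl _)
ded (hyp (there i))   = mp (hyp i) (thm (ax-K _ _))
ded (mp d e)          = mp (ded d) (mp (ded e) (thm (ax-S _ _ _)))

module _ {Γ : List Formula} where

  ∧-intro : ∀ {α β} → Γ ⊩ α → Γ ⊩ β → Γ ⊩ α ∧̇ β
  ∧-intro d e = mp e (mp d (thm (ax-∧I _ _)))

  ∧-elim₁ : ∀ {α β} → Γ ⊩ α ∧̇ β → Γ ⊩ α
  ∧-elim₁ d = mp d (thm (ax-∧E₁ _ _))

  ∧-elim₂ : ∀ {α β} → Γ ⊩ α ∧̇ β → Γ ⊩ β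
  ∧-elim₂ d = mp d (thm (ax-∧E₂ _ _))

  ∨-elim : ∀ {α β χ} → Γ ⊩ α ∨̇ β → Γ ⊩ α ⇒ χ → Γ ⊩ β ⇒ χ → Γ ⊩ χ
  ∨-elim d e f = mp d (mp f (mp e (thm (ax-∨E _ _ _))))

  explosion : ∀ {α χ} → Γ ⊩ ∘̇ α → Γ ⊩ α → Γ ⊩ ¬̇ α → Γ ⊩ χ
  explosion c d e = mp e (mp d (mp c (thm (ax-bc _ _))))

-- Falsum, signed formulas and truth tables.

-- RmbC has no falsum constant, and ¬̇ is paraconsistent.
⊥̇ : Formula
⊥̇ = ∘̇ var 0 ∧̇ (var 0 ∧̇ ¬̇ var 0)

⊥-exfalso : ∀ {Γ χ} → Γ ⊩ ⊥̇ → Γ ⊩ χ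
⊥-exfalso d = explosion (∧-elim₁ d) (∧-elim₁ (∧-elim₂ d)) (∧-elim₂ (∧-elim₂ d))

signed : Formula → Bool → Formula
signed α true  = α
signed α false = α ⇒ ⊥̇

-- The axiom `ax-⇒∨` at `⊥̇` supplies the classical dichotomy; `ax-EM` would not, since `¬̇ α` need
-- not refute `α`.
split : ∀ {Γ χ} α → (∀ b → signed α b ∷ Γ ⊩ χ) → Γ ⊩ χ
split α d = ∨-elim (thm (ax-⇒∨ α ⊥̇)) (ded (d false)) (ded (d true))

signed-∧ : ∀ {Γ α β} b c → Γ ⊩ signed α b → Γ ⊩ signed β c → Γ ⊩ signed (α ∧̇ β) (b ∧ c)
signed-∧ true  true  d e = ∧-intro d e
signed-∧ true  false d e = ded (mp (∧-elim₂ (hyp (here refl))) (weaken there e))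
signed-∧ false c     d e = ded (mp (∧-elim₁ (hyp (here refl))) (weaken there d))

signed-∨ : ∀ {Γ α β} b c → Γ ⊩ signed α b → Γ ⊩ signed β c → Γ ⊩ signed (α ∨̇ β) (b ∨ c)
signed-∨ true  c     d e = mp d (thm (ax-∨I₁ _ _))
signed-∨ false true  d e = mp e (thm (ax-∨I₂ _ _))
signed-∨ false false d e = ded (∨-elim (hyp (here refl)) (weaken there d) (weaken there e))

signed-⇒ : ∀ {Γ α β} b c → Γ ⊩ signed α b → Γ ⊩ signed β c → Γ ⊩ signed (α ⇒ β) (not b ∨ c)
signed-⇒ false c     d e = ded (⊥-exfalso (mp (hyp (here refl)) (weaken there d)))
signed-⇒ true  true  d e = mp e (thm (ax-K _ _))
signed-⇒ true  false d e = ded (mp (mp (weaken there d) (hyp (here refl))) (weaken there e))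

iff-intro : ∀ {Γ α β} b → Γ ⊩ signed α b → Γ ⊩ signed β b → Γ ⊩ α ⇔̇ β
iff-intro true  d e = ∧-intro (signed-⇒ true true d e) (signed-⇒ true true e d)
iff-intro false d e = ∧-intro (signed-⇒ false false d e) (signed-⇒ false false e d)

-- Subformulas.

subformulas : Formula → List Formula
subformulas φ@(var _)  = φ ∷ []
subformulas φ@(α ∧̇ β) = φ ∷ subformulas α ++ subformulas β
subformulas φ@(α ∨̇ β) = φ ∷ subformulas α ++ subformulas β
subformulas φ@(α ⇒ β)  = φ ∷ subformulas α ++ subformulas β
subformulas φ@(¬̇ α)    = φ ∷ subformulas α
subformulas φ@(∘̇ α)    = φ ∷ subformulas α

self : ∀ φ → φ ∈ subformulas φ
self (var _)  = here refl
self (_ ∧̇ _) = here refl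
self (_ ∨̇ _) = here refl
self (_ ⇒ _)  = here refl
self (¬̇ _)    = here refl
self (∘̇ _)    = here refl

subformulas-⊆ : ∀ φ {ψ} → ψ ∈ subformulas φ → subformulas ψ ⊆ subformulas φ

subformulas-++-⊆ : ∀ α β {ψ} → ψ ∈ subformulas α ++ subformulas β →
                   subformulas ψ ⊆ subformulas α ++ subformulas β
subformulas-++-⊆ α β i with ∈-++⁻ (subformulas α) i
... | inj₁ j = ∈-++⁺ˡ ∘ subformulas-⊆ α j
... | inj₂ j = ∈-++⁺ʳ (subformulas α) ∘ subformulas-⊆ β j

subformulas-⊆ (var _)  (here refl) = id
subformulas-⊆ (α ∧̇ β) (here refl) = id
subformulas-⊆ (α ∧̇ β) (there i)   = there ∘ subformulas-++-⊆ α β i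
subformulas-⊆ (α ∨̇ β) (here refl) = id
subformulas-⊆ (α ∨̇ β) (there i)   = there ∘ subformulas-++-⊆ α β i
subformulas-⊆ (α ⇒ β)  (here refl) = id
subformulas-⊆ (α ⇒ β)  (there i)   = there ∘ subformulas-++-⊆ α β i
subformulas-⊆ (¬̇ α)    (here refl) = id
subformulas-⊆ (¬̇ α)    (there i)   = there ∘ subformulas-⊆ α i
subformulas-⊆ (∘̇ α)    (here refl) = id
subformulas-⊆ (∘̇ α)    (there i)   = there ∘ subformulas-⊆ α i

-- Worlds and evaluation.

-- Entries at conjunctions, disjunctions and implications are ignored by eval.
World : List Formula → Set
World = All (λ _ → Bool)

worlds : ∀ S → List (World S)
worlds []      = [] ∷ []
worlds (_ ∷ S) = map (true ∷_) (worlds S) ++ map (false ∷_) (worlds S)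

∈-worlds : ∀ {α S} b {w : World S} → w ∈ worlds S → b ∷ w ∈ worlds (α ∷ S)
∈-worlds         true  i = ∈-++⁺ˡ (∈-map⁺ (true ∷_) i)
∈-worlds {S = S} false i = ∈-++⁺ʳ (map (true ∷_) (worlds S)) (∈-map⁺ (false ∷_) i)

literals : ∀ {S} → World S → List Formula
literals = All.reduce (λ {α} b → signed α b)

∈-literals : ∀ {S α} (w : World S) (i : α ∈ S) → signed α (All.lookup w i) ∈ literals w
∈-literals (b ∷ w) (here refl) = here refl
∈-literals (b ∷ w) (there i)   = there (∈-literals w i)

-- Amounts to saying that the disjunction over `W` of the conjunctions of literals is a theorem, in
-- elimination form. This is the invariant of the deletion process.
Adequate : ∀ {S} → List (World S) → Set
Adequate W = ∀ {χ} → (∀ {w} → w ∈ W → literals w ⊩ χ) → ⊢ χ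

worlds-adequate : ∀ S → Adequate (worlds S)
worlds-adequate []      h = close (h (here refl))
worlds-adequate (α ∷ S) h =
  worlds-adequate S (λ w∈W → split α (λ b → h (∈-worlds b w∈W)))

-- The junk value false outside S makes value w α ≡ true imply α ∈ S.
value : ∀ {S} → World S → Formula → Bool
value {S} w α with any? (α ≟_) S
... | yes i = All.lookup w i
... | no  _ = false

-- `S` may list a formula twice and a world may give the copies clashing entries; `value` reads one
-- occurrence, whose literal is among the hypotheses.
value-signed : ∀ {S α} (w : World S) → α ∈ S → literals w ⊩ signed α (value w α)
value-signed {S} {α} w α∈S with any? (α ≟_) S
... | yes i = hyp (∈-literals w i)
... | no ¬i = contradiction α∈S ¬i

value-true : ∀ {S} α (w : World S) → value w α ≡ true → literals w ⊩ α
value-true {S} α w eq with any? (α ≟_) S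
... | yes i = subst (λ b → literals w ⊩ signed α b) eq (hyp (∈-literals w i))

eval : ∀ {S} → Formula → World S → Bool
eval φ@(var _) w = value w φ
eval (α ∧̇ β)  w = eval α w ∧ eval β w
eval (α ∨̇ β)  w = eval α w ∨ eval β w
eval (α ⇒ β)   w = not (eval α w) ∨ eval β w
eval φ@(¬̇ _)   w = value w φ
eval φ@(∘̇ _)   w = value w φ

-- Kalmár's lemma, with variables and formulas starting in `¬̇` or `∘̇` as the atoms.
eval-signed : ∀ {S} φ (w : World S) → subformulas φ ⊆ S → literals w ⊩ signed φ (eval φ w)
eval-signed (var _)  w φ⊆S = value-signed w (φ⊆S (here refl))
eval-signed (α ∧̇ β) w φ⊆S =
  signed-∧ (eval α w) (eval β w)
    (eval-signed α w (φ⊆S ∘ there ∘ ∈-++⁺ˡ))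
    (eval-signed β w (φ⊆S ∘ there ∘ ∈-++⁺ʳ (subformulas α)))
eval-signed (α ∨̇ β) w φ⊆S =
  signed-∨ (eval α w) (eval β w)
    (eval-signed α w (φ⊆S ∘ there ∘ ∈-++⁺ˡ))
    (eval-signed β w (φ⊆S ∘ there ∘ ∈-++⁺ʳ (subformulas α)))
eval-signed (α ⇒ β)  w φ⊆S =
  signed-⇒ (eval α w) (eval β w)
    (eval-signed α w (φ⊆S ∘ there ∘ ∈-++⁺ˡ))
    (eval-signed β w (φ⊆S ∘ there ∘ ∈-++⁺ʳ (subformulas α)))
eval-signed (¬̇ _)    w φ⊆S = value-signed w (φ⊆S (here refl))
eval-signed (∘̇ _)    w φ⊆S = value-signed w (φ⊆S (here refl))

-- The algebra of subsets of a list of worlds.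

iff⇒≡ : ∀ x y → (not x ∨ y) ∧ (not y ∨ x) ≡ true → x ≡ y
iff⇒≡ true  true  _ = refl
iff⇒≡ false false _ = refl

≡⇒iff : ∀ {x y} → x ≡ y → (not x ∨ y) ∧ (not y ∨ x) ≡ true
≡⇒iff {true}  refl = refl
≡⇒iff {false} refl = refl

modus-ponens : ∀ {x y} → x ≡ true → not x ∨ y ≡ true → y ≡ true
modus-ponens refl q = q

module Model {S : List Formula} (W : List (World S)) where

  infix 4 _≈_ _≈?_
  _≈_ : (X Y : World S → Bool) → Set
  X ≈ Y = All (λ w → X w ≡ Y w) W

  _≈?_ : ∀ X Y → Dec (X ≈ Y)
  X ≈? Y = all? (λ w → X w Bool.≟ Y w) W

  ≈-trans : ∀ {X Y Z} → X ≈ Y → Y ≈ Z → X ≈ Z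
  ≈-trans p q = All.zipWith (uncurry trans) (p , q)

  ≈-sym : ∀ {X Y} → X ≈ Y → Y ≈ X
  ≈-sym = All.map sym

  -- `γ` is compared with `X` only through its truth set on `W`, which turns the connective `k` into
  -- an operation on subsets of `W`.
  Match : (Formula → Formula) → (World S → Bool) → World S → Set
  Match k X w = Any (λ γ → eval γ ≈ X × value w (k γ) ≡ true) S

  match? : ∀ k X w → Dec (Match k X w)
  match? k X w = any? (λ γ → eval γ ≈? X ×-dec value w (k γ) Bool.≟ true) S

  match-resp : ∀ k {X Y} → X ≈ Y → ∀ w → does (match? k X w) ≡ does (match? k Y w)
  match-resp k X≈Y w = does-⇔ (mk⇔ (Any.map λ (p , q) → ≈-trans p X≈Y , q)
                                     (Any.map λ (p , q) → ≈-trans p (≈-sym X≈Y) , q))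
                              (match? k _ w) (match? k _ w)

  -- The disjunct not (X w) and the conjunct not (X w ∧ neg X w) make the
  -- axioms EM and bc hold whatever W is.
  neg circ : (World S → Bool) → World S → Bool
  neg  X w = not (X w) ∨ does (match? ¬̇_ X w)
  circ X w = not (X w ∧ neg X w) ∧ does (match? ∘̇_ X w)

  neg-cong : ∀ {X Y} → X ≈ Y → neg X ≈ neg Y
  neg-cong X≈Y = All.map (λ {w} eq → cong₂ (λ x m → not x ∨ m) eq (match-resp ¬̇_ X≈Y w)) X≈Y

  circ-cong : ∀ {X Y} → X ≈ Y → circ X ≈ circ Y
  circ-cong X≈Y =
    All.zipWith (λ {w} (eq , neq) →
                   cong₂ _∧_ (cong not (cong₂ _∧_ eq neq)) (match-resp ∘̇_ X≈Y w))
                (X≈Y , neg-cong X≈Y)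

  ⟦_⟧ : Formula → World S → Bool
  ⟦ φ@(var _) ⟧ w = value w φ
  ⟦ α ∧̇ β ⟧    w = ⟦ α ⟧ w ∧ ⟦ β ⟧ w
  ⟦ α ∨̇ β ⟧    w = ⟦ α ⟧ w ∨ ⟦ β ⟧ w
  ⟦ α ⇒ β ⟧     w = not (⟦ α ⟧ w) ∨ ⟦ β ⟧ w
  ⟦ ¬̇ α ⟧         = neg ⟦ α ⟧
  ⟦ ∘̇ α ⟧         = circ ⟦ α ⟧

  ⟦⟧-≈ : ∀ α β → (∀ {w} → w ∈ W → ⟦ α ⇔̇ β ⟧ w ≡ true) → ⟦ α ⟧ ≈ ⟦ β ⟧
  ⟦⟧-≈ α β h = All.tabulate (λ w∈W → iff⇒≡ _ _ (h w∈W))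

  -- For R¬ and R∘, a biconditional true at every world of `W` makes the two truth sets equal on
  -- `W`, and `neg` and `circ` respect that equality.
  sound : ∀ {φ} → ⊢ φ → ∀ {w} → w ∈ W → ⟦ φ ⟧ w ≡ true
  sound (ax-K α β) {w} _ with ⟦ α ⟧ w | ⟦ β ⟧ w
  ... | true  | true  = refl
  ... | true  | false = refl
  ... | false | _     = refl
  sound (ax-S α β γ) {w} _ with ⟦ α ⟧ w | ⟦ β ⟧ w | ⟦ γ ⟧ w
  ... | true  | true  | true  = refl
  ... | true  | true  | false = refl
  ... | true  | false | _     = refl
  ... | false | _     | _     = refl
  sound (ax-∧I α β) {w} _ with ⟦ α ⟧ w | ⟦ β ⟧ w
  ... | true  | true  = refl
  ... | true  | false = refl
  ... | false | _     = refl
  sound (ax-∧E₁ α β) {w} _ with ⟦ α ⟧ w | ⟦ β ⟧ w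
  ... | true  | true  = refl
  ... | true  | false = refl
  ... | false | _     = refl
  sound (ax-∧E₂ α β) {w} _ with ⟦ α ⟧ w | ⟦ β ⟧ w
  ... | true  | true  = refl
  ... | true  | false = refl
  ... | false | _     = refl
  sound (ax-∨I₁ α β) {w} _ with ⟦ α ⟧ w
  ... | true  = refl
  ... | false = refl
  sound (ax-∨I₂ α β) {w} _ with ⟦ α ⟧ w | ⟦ β ⟧ w
  ... | true  | true  = refl
  ... | true  | false = refl
  ... | false | true  = refl
  ... | false | false = refl
  sound (ax-∨E α β γ) {w} _ with ⟦ α ⟧ w | ⟦ β ⟧ w | ⟦ γ ⟧ w
  ... | true  | true  | true  = refl
  ... | true  | true  | false = refl
  ... | true  | false | true  = refl
  ... | true  | false | false = refl
  ... | false | true  | true  = refl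
  ... | false | true  | false = refl
  ... | false | false | _     = refl
  sound (ax-⇒∨ α β) {w} _ with ⟦ α ⟧ w | ⟦ β ⟧ w
  ... | true  | true  = refl
  ... | true  | false = refl
  ... | false | _     = refl
  sound (ax-EM α) {w} _ with ⟦ α ⟧ w
  ... | true  = refl
  ... | false = refl
  sound (ax-bc α β) {w} _ with ⟦ α ⟧ w | does (match? ¬̇_ ⟦ α ⟧ w) | does (match? ∘̇_ ⟦ α ⟧ w)
  ... | true  | true  | _     = refl
  ... | true  | false | true  = refl
  ... | true  | false | false = refl
  ... | false | _     | true  = refl
  ... | false | _     | false = refl
  sound (MP d e) w∈W = modus-ponens (sound d w∈W) (sound e w∈W)
  sound (R¬ {α} {ψ} d) w∈W = ≡⇒iff (All.lookup (neg-cong (⟦⟧-≈ α ψ (sound d))) w∈W)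
  sound (R∘ {α} {ψ} d) w∈W = ≡⇒iff (All.lookup (circ-cong (⟦⟧-≈ α ψ (sound d))) w∈W)

  -- Agreement of worlds with the model.

  -- `neg` and `circ` act on `eval α` rather than `⟦ α ⟧`, so the test reads only entries of the
  -- worlds.
  Agrees : Formula → World S → Set
  Agrees φ@(¬̇ α) w = neg (eval α) w ≡ value w φ
  Agrees φ@(∘̇ α) w = circ (eval α) w ≡ value w φ
  Agrees _       w = ⊤

  agrees? : ∀ φ w → Dec (Agrees φ w)
  agrees? (var _)  w = yes tt
  agrees? (_ ∧̇ _) w = yes tt
  agrees? (_ ∨̇ _) w = yes tt
  agrees? (_ ⇒ _)  w = yes tt
  agrees? (¬̇ _)    w = _ Bool.≟ _
  agrees? (∘̇ _)    w = _ Bool.≟ _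

  Good : World S → Set
  Good w = All (λ φ → Agrees φ w) S

  good? : ∀ w → Dec (Good w)
  good? w = all? (λ φ → agrees? φ w) S

  -- Congruence replaces `⟦ α ⟧` by `eval α` under `neg` or `circ`, and goodness equates the result
  -- with the entry. Congruence rests on agreement over all of `W`, hence goodness of every world.
  ⟦⟧≈eval : All Good W → ∀ φ → subformulas φ ⊆ S → ⟦ φ ⟧ ≈ eval φ
  ⟦⟧≈eval good (var _)  φ⊆S = All.tabulate (λ _ → refl)
  ⟦⟧≈eval good (α ∧̇ β) φ⊆S =
    All.zipWith (uncurry (cong₂ _∧_))
      ( ⟦⟧≈eval good α (φ⊆S ∘ there ∘ ∈-++⁺ˡ)
      , ⟦⟧≈eval good β (φ⊆S ∘ there ∘ ∈-++⁺ʳ (subformulas α)))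
  ⟦⟧≈eval good (α ∨̇ β) φ⊆S =
    All.zipWith (uncurry (cong₂ _∨_))
      ( ⟦⟧≈eval good α (φ⊆S ∘ there ∘ ∈-++⁺ˡ)
      , ⟦⟧≈eval good β (φ⊆S ∘ there ∘ ∈-++⁺ʳ (subformulas α)))
  ⟦⟧≈eval good (α ⇒ β)  φ⊆S =
    All.zipWith (uncurry (cong₂ (λ x y → not x ∨ y)))
      ( ⟦⟧≈eval good α (φ⊆S ∘ there ∘ ∈-++⁺ˡ)
      , ⟦⟧≈eval good β (φ⊆S ∘ there ∘ ∈-++⁺ʳ (subformulas α)))
  ⟦⟧≈eval good (¬̇ α)    φ⊆S =
    ≈-trans (neg-cong (⟦⟧≈eval good α (φ⊆S ∘ there)))
            (All.map (λ g → All.lookup g (φ⊆S (here refl))) good)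
  ⟦⟧≈eval good (∘̇ α)    φ⊆S =
    ≈-trans (circ-cong (⟦⟧≈eval good α (φ⊆S ∘ there)))
            (All.map (λ g → All.lookup g (φ⊆S (here refl))) good)

  -- Refutation of the deleted worlds.

  module _ (closed : ∀ {φ} → φ ∈ S → subformulas φ ⊆ S) (adequate : Adequate W) where

    complete : ∀ {φ} → φ ∈ S → All (λ w → eval φ w ≡ true) W → ⊢ φ
    complete {φ} φ∈S h = adequate λ {w} w∈W →
      subst (λ b → literals w ⊩ signed φ b) (All.lookup h w∈W) (eval-signed φ w (closed φ∈S))

    ≈⇒⊢⇔ : ∀ {α β} → α ∈ S → β ∈ S → eval α ≈ eval β → ⊢ α ⇔̇ β
    ≈⇒⊢⇔ {α} {β} α∈S β∈S α≈β = adequate λ {w} w∈W →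
      iff-intro (eval α w) (eval-signed α w (closed α∈S))
        (subst (λ b → literals w ⊩ signed β b) (sym (All.lookup α≈β w∈W))
               (eval-signed β w (closed β∈S)))

    -- R¬ or R∘, applied to the theorem `γ ⇔̇ α`, carries the literal `k γ` of the matching `γ` over
    -- to `k α`.
    match⇒⊩ : ∀ k {α w} → (∀ {β γ} → ⊢ β ⇔̇ γ → ⊢ k β ⇔̇ k γ) →
              α ∈ S → Match k (eval α) w → literals w ⊩ k α
    match⇒⊩ k {α} {w} k-cong α∈S m with find m
    ... | γ , γ∈S , γ≈α , kγ =
      mp (value-true (k γ) w kγ) (∧-elim₁ (thm (k-cong (≈⇒⊢⇔ γ∈S α∈S γ≈α))))

    match-self : ∀ k {α w} → α ∈ S → value w (k α) ≡ true → Match k (eval α) w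
    match-self k α∈S kα = lose α∈S (All.tabulate (λ _ → refl) , kα)

    -- A false entry clashes with excluded middle or with a formula derived from a match. A true
    -- entry always has `α` as its own match, so it can clash only through bc.
    disagrees⇒⊥ : ∀ {φ w} → φ ∈ S → ¬ Agrees φ w → literals w ⊩ ⊥̇
    disagrees⇒⊥ {var _}  _ ¬a = contradiction tt ¬a
    disagrees⇒⊥ {_ ∧̇ _} _ ¬a = contradiction tt ¬a
    disagrees⇒⊥ {_ ∨̇ _} _ ¬a = contradiction tt ¬a
    disagrees⇒⊥ {_ ⇒ _}  _ ¬a = contradiction tt ¬a
    disagrees⇒⊥ {¬̇ α} {w} φ∈S ¬a
      with eval α w | eval-signed α w (closed φ∈S ∘ there)
         | value w (¬̇ α) in v | value-signed w φ∈S | match? ¬̇_ (eval α) w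
    ... | true  | _ | true  | _ | yes _ = contradiction refl ¬a
    ... | false | _ | true  | _ | _     = contradiction refl ¬a
    ... | true  | _ | true  | _ | no ¬m =
      contradiction (match-self ¬̇_ (closed φ∈S (there (self α))) v) ¬m
    ... | false | d | false | e | _     = ∨-elim (thm (ax-EM α)) d e
    ... | true  | _ | false | e | yes m = mp (match⇒⊩ ¬̇_ R¬ (closed φ∈S (there (self α))) m) e
    ... | true  | _ | false | _ | no _  = contradiction refl ¬a
    disagrees⇒⊥ {∘̇ α} {w} φ∈S ¬a
      with eval α w | eval-signed α w (closed φ∈S ∘ there)
         | value w (∘̇ α) in v | value-signed w φ∈S
         | match? ¬̇_ (eval α) w | match? ∘̇_ (eval α) w
    -- Where `α` is true, `neg` is true only through a match, so `¬̇ α` is derivable alongside `α`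
    -- and `∘̇ α`.
    ... | true  | d | true  | c | yes m | _     =
      explosion c d (match⇒⊩ ¬̇_ R¬ (closed φ∈S (there (self α))) m)
    ... | true  | _ | true  | _ | no _  | yes _ = contradiction refl ¬a
    ... | false | _ | true  | _ | _     | yes _ = contradiction refl ¬a
    ... | _     | _ | true  | _ | _     | no ¬m =
      contradiction (match-self ∘̇_ (closed φ∈S (there (self α))) v) ¬m
    ... | _     | _ | false | e | _     | yes m = mp (match⇒⊩ ∘̇_ R∘ (closed φ∈S (there (self α))) m) e
    -- With no match the second conjunct of `circ` is false, as the entry is; the first conjunct
    -- stays symbolic, so `∧-zeroʳ` replaces reduction.
    ... | x     | _ | false | _ | m     | no _  =
      contradiction (Bool.∧-zeroʳ (not (x ∧ (not x ∨ does m)))) ¬a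

    -- The literals of a deleted world yield `⊥̇` and hence every `χ`, so `h` is only called on for
    -- surviving worlds.
    filter-adequate : Adequate (filter good? W)
    filter-adequate h = adequate λ {w} w∈W → case-good w∈W (good? w)
      where
      case-good : ∀ {w} → w ∈ W → Dec (Good w) → literals w ⊩ _
      case-good w∈W (yes good) = h (∈-filter⁺ good? w∈W good)
      case-good {w} w∈W (no ¬good) with find (¬All⇒Any¬ (λ φ → agrees? φ w) S ¬good)
      ... | φ , φ∈S , ¬a = ⊥-exfalso (disagrees⇒⊥ φ∈S ¬a)

-- Saturation and the decision procedure.

open Model

-- Shrinking `W` can change `neg` and `circ`, so surviving worlds may turn bad and the test is
-- repeated; each further round has at least one world fewer.
saturate : ∀ {S} → (∀ {φ} → φ ∈ S → subformulas φ ⊆ S) →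
           (W : List (World S)) → Adequate W → Acc ℕ._<_ (length W) →
           ∃ λ W′ → Adequate W′ × All (Good W′) W′
saturate closed W adequate (acc rec) with all? (good? W) W
... | yes good = W , adequate , good
... | no ¬good =
  saturate closed (filter (good? W) W) (filter-adequate W closed adequate)
    (rec (filter-notAll (good? W) W (¬All⇒Any¬ (good? W) W ¬good)))

corollary4p5 : Decidable ⊢_
corollary4p5 φ
  with saturate (subformulas-⊆ φ) (worlds S) (worlds-adequate S) (<-wellFounded _)
  where S = subformulas φ
... | W , adequate , good =
  map′ (complete W (subformulas-⊆ φ) adequate (self φ))
       -- A theorem is true in the model by soundness, and the model agrees with `eval` on `φ`
       -- because all worlds left are good.
       (λ d → All.zipWith (λ (p , q) → trans (sym p) q)
                (⟦⟧≈eval W good φ id , All.tabulate (sound W d)))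
       (all? (λ w → eval φ w Bool.≟ true) W)
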